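{- Let $G$ be an isolate-free graph with minimum degree $\delta(G)$ and maximum degree $\Delta(G)$. If $\delta(G)<\left\lfloor\frac{\Delta(G)+2}{2}\right\rfloor$, then $$TC(G)\le \delta(G)\,\bigl(\Delta(G)-\delta(G)+2\bigr).$$
   Context: All graphs are finite and simple (no loops or multiple edges). A graph is isolate-free if it has no vertex of degree $0$. A set $T\subseteq V$ of vertices of a graph $G(V,E)$ is a total dominating set if every vertex of $V$ is adjacent to at least one vertex of $T$. Two disjoint sets $A,B\subset V$ form a total coalition if neither $A$ nor $B$ is a total dominating set, but $A\cup B$ is. A total coalition partition of $G$ is a partition $\Psi=\{C_1,\dots,C_k\}$ of $V$ into non-empty classes such that for every $i$ there exists $j\neq i$ such that $C_i$ and $C_j$ form a total coalition. The total coalition number $TC(G)$ of an isolate-free graph $G$ is the maximum cardinality (number of classes) of a total coalition partition of $G$. -}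

module Defs where

open import Level using (0ℓ)
open import Data.Nat.Base using (ℕ; _≤_)
open import Data.Fin.Base using (Fin)
open import Data.Fin.Subset using (Subset; _∈_; _∩_; _∪_; ∣_∣; Nonempty; Empty)
open import Data.List.Base using (map; allFin)
open import Data.List.Extrema.Nat using (min; max)
open import Data.Product.Base using (∃; _×_)
open import Data.Vec.Base using (tabulate)
open import Relation.Binary.Core using (Rel)
open import Relation.Binary.Definitions using (Decidable; Irreflexive; Symmetric)
open import Relation.Binary.PropositionalEquality.Core using (_≡_; _≢_)
open import Relation.Nullary using (¬_; does)

-- Adjacency is decidable because the graphs are finite combinatorial
-- objects; classically this is no restriction.
record Graph (n : ℕ) : Set₁ where
  field
    Adj      : Rel (Fin n) 0ℓ
    adj?     : Decidable Adj
    symm     : Symmetric Adj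
    loopless : Irreflexive _≡_ Adj

open Graph public

module _ {n : ℕ} (G : Graph n) where

  neighbourhood : Fin n → Subset n
  neighbourhood v = tabulate λ u → does (adj? G v u)

  degree : Fin n → ℕ
  degree v = ∣ neighbourhood v ∣

  -- The extra argument of min (max) only matters when n = 0, as every
  -- degree lies between 0 and n.
  minDegree maxDegree : ℕ
  minDegree = min n (map degree (allFin n))
  maxDegree = max 0 (map degree (allFin n))

  IsolateFree : Set
  IsolateFree = ∀ v → degree v ≢ 0

  TotalDominating : Subset n → Set
  TotalDominating T = ∀ v → ∃ λ u → u ∈ T × Adj G v u

  record TotalCoalition (A B : Subset n) : Set where
    field
      disjoint : Empty (A ∩ B)
      ¬left    : ¬ TotalDominating A
      ¬right   : ¬ TotalDominating B
      union    : TotalDominating (A ∪ B)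

  -- Since classes are non-empty and pairwise disjoint, the indexing is
  -- injective, so k is the number of classes.
  record IsPartition {k : ℕ} (C : Fin k → Subset n) : Set where
    field
      nonempty : ∀ i → Nonempty (C i)
      disjoint : ∀ {i j} → i ≢ j → Empty (C i ∩ C j)
      covers   : ∀ v → ∃ λ i → v ∈ C i

  record IsTotalCoalitionPartition {k : ℕ} (C : Fin k → Subset n) : Set where
    field
      isPartition : IsPartition C
      partner     : ∀ i → ∃ λ j → j ≢ i × TotalCoalition (C i) (C j)

  -- IsTC t reads "TC(G) = t". The maximum is given as a relation because
  -- TC(G) has a value only if some total coalition partition exists.
  record IsTC (t : ℕ) : Set where
    field
      attained : ∃ λ (C : Fin t → Subset n) → IsTotalCoalitionPartition C
      maximal  : ∀ {k} {C : Fin k → Subset n} → IsTotalCoalitionPartition C → k ≤ t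

{-# OPTIONS --safe #-}

-- Call a class near a vertex v when it meets the neighbourhood N(v); two classes
-- forming a total coalition cannot both fail to be near v. Let x have degree δ and
-- let D be the set of classes near x, so that |D| ≤ δ and every class outside D has
-- its partner in D. Choose for each class i a vertex uᵢ that i does not dominate,
-- and let Mᵢ be the set of classes near uᵢ; then i ∉ Mᵢ and |Mᵢ| ≤ Δ. Take I ⊆ D
-- minimal such that every j ∈ D lies outside Mᵢ for some i ∈ I. A class outside D
-- with partner j then lies in Mᵢ, so the classes outside D are covered by the
-- sets Mᵢ ∖ D with i ∈ I. By minimality every i ∈ I has a private j ∈ D, which lies
-- in Mᵢ′ for all other i′ ∈ I; hence |Mᵢ ∩ D| ≥ |I| − 1. With s = |I| this gives at
-- most δ + s(Δ + 1 − s) classes, and s(Δ + 1 − s) is nondecreasing for s ≤ δ ≤ Δ/2.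
module Submission where

open import Defs
open import Data.Nat using (ℕ; _+_; _*_; _∸_; _≤_; _<_)
open import Data.Nat.DivMod using (_/_)
open import Level using (0ℓ)
open import Data.Fin.Base using (Fin; zero; suc)
open import Data.Fin.Properties using (_≟_; suc-injective; any?; all?; ¬∀⟶∃¬)
open import Data.Fin.Subset
  using (Subset; inside; outside; _∈_; _∉_; _∩_; _-_; ∁; ⁅_⁆; _⊂_; ∣_∣)
open import Data.Fin.Subset.Induction using (⊂-wellFounded)
open import Data.Fin.Subset.Properties
open import Data.List.Base using (map; allFin)
open import Data.List.Extrema.Nat using (argmin-sel; v≤max⁺)
open import Data.List.Membership.Propositional.Properties using (∈-map⁻; ∈-map⁺; ∈-allFin)
open import Data.List.Relation.Unary.Any as Any using ()
open import Data.Nat using (zero; suc; z≤n; s≤s)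
open import Data.Nat.DivMod using (m/n*n≤m)
open import Data.Nat.Properties
  using (≤-trans; ≤-refl; ≤-reflexive; +-suc; +-comm; +-assoc; +-mono-≤; +-monoˡ-≤; +-monoʳ-≤;
         *-monoˡ-≤; m≤m+n; m+n∸m≡n; m+[n∸m]≡n; m≤n⇒∃[o]m+o≡n;
         m+n≤o⇒m≤o∸n; +-cancelʳ-≤; module ≤-Reasoning)
open import Data.Nat.Tactic.RingSolver using (solve-∀)
open import Data.Product.Base using (∃; _×_; _,_; proj₁; proj₂)
open import Data.Sum.Base using (inj₁; inj₂)
open import Data.Vec.Base using ([]; _∷_; here; there; tabulate)
open import Data.Vec.Properties using ([]=⇒lookup; lookup⇒[]=; lookup∘tabulate)
open import Function.Base using (_∘_; id)
open import Induction.WellFounded using (Acc; acc)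
open import Relation.Binary.PropositionalEquality
  using (_≡_; _≢_; refl; sym; trans; cong)
open import Relation.Nullary using (¬_; Dec; yes; no; does; contradiction)
open import Relation.Nullary.Decidable
  using (dec-true; decidable-stable; _×-dec_; _→-dec_; ¬?)
open import Relation.Unary using (Pred; Decidable)

private variable
  m n k : ℕ

-- Counting in finite subsets.

module _ {P : Pred (Fin n) 0ℓ} (P? : Decidable P) where

  ∈-tabulate-does⁺ : ∀ {i} → P i → i ∈ tabulate (does ∘ P?)
  ∈-tabulate-does⁺ {i} p =
    lookup⇒[]= i _ (trans (lookup∘tabulate _ i) (dec-true (P? i) p))

  ∈-tabulate-does⁻ : ∀ {i} → i ∈ tabulate (does ∘ P?) → P i
  ∈-tabulate-does⁻ {i} i∈ with P? i | trans (sym (lookup∘tabulate (does ∘ P?) i)) ([]=⇒lookup i∈)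
  ... | yes p | _  = p
  ... | no  _ | ()

∣p∣≡∣p∩q∣+∣p∩∁q∣ : (p q : Subset n) → ∣ p ∣ ≡ ∣ p ∩ q ∣ + ∣ p ∩ ∁ q ∣
∣p∣≡∣p∩q∣+∣p∩∁q∣ []            []            = refl
∣p∣≡∣p∩q∣+∣p∩∁q∣ (outside ∷ p) (_       ∷ q) = ∣p∣≡∣p∩q∣+∣p∩∁q∣ p q
∣p∣≡∣p∩q∣+∣p∩∁q∣ (inside  ∷ p) (inside  ∷ q) = cong suc (∣p∣≡∣p∩q∣+∣p∩∁q∣ p q)
∣p∣≡∣p∩q∣+∣p∩∁q∣ (inside  ∷ p) (outside ∷ q) =
  trans (cong suc (∣p∣≡∣p∩q∣+∣p∩∁q∣ p q)) (sym (+-suc _ _))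

-- Matching by a relation lets the partner of `i` depend on the proof of `i ∈ p`; injectivity is
-- asked of `R` alone. The induction removes from `q` the partner of the head of `p`.
injective⇒∣p∣≤∣q∣ : (p : Subset m) (q : Subset n) (R : Fin m → Fin n → Set) →
  (∀ {i} → i ∈ p → ∃ λ j → j ∈ q × R i j) →
  (∀ {i i′ j} → R i j → R i′ j → i ≡ i′) →
  ∣ p ∣ ≤ ∣ q ∣
injective⇒∣p∣≤∣q∣ []            q R total inj = z≤n
injective⇒∣p∣≤∣q∣ (outside ∷ p) q R total inj =
  injective⇒∣p∣≤∣q∣ p q (R ∘ suc) (total ∘ there) λ r r′ → suc-injective (inj r r′)
injective⇒∣p∣≤∣q∣ (inside  ∷ p) q R total inj with total here
... | j₀ , j₀∈q , r₀ = ≤-trans (s≤s ∣p∣≤∣q-j₀∣) (x∈p⇒∣p-x∣<∣p∣ j₀∈q)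
  where
  avoid : ∀ {i} → i ∈ p → ∃ λ j → j ∈ q - j₀ × R (suc i) j
  avoid i∈p with total (there i∈p)
  ... | j , j∈q , r = j , x∈p∧x≢y⇒x∈p-y j∈q (λ { refl → contradiction (inj r₀ r) λ () }) , r
  ∣p∣≤∣q-j₀∣ : ∣ p ∣ ≤ ∣ q - j₀ ∣
  ∣p∣≤∣q-j₀∣ = injective⇒∣p∣≤∣q∣ p (q - j₀) (R ∘ suc) avoid λ r r′ → suc-injective (inj r r′)

cover⇒∣q∣≤∣p∣*b : (p : Subset m) (M : Fin m → Subset n) (q : Subset n) (b : ℕ) →
  (∀ {i} → i ∈ p → ∣ M i ∣ ≤ b) →
  (∀ {j} → j ∈ q → ∃ λ i → i ∈ p × j ∈ M i) →
  ∣ q ∣ ≤ ∣ p ∣ * b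
cover⇒∣q∣≤∣p∣*b {n = n} [] M q b bound cov
  rewrite Empty-unique {p = q} (λ { (_ , j∈q) → contradiction (proj₁ (cov j∈q)) λ () }) =
  ≤-reflexive (∣⊥∣≡0 n)
cover⇒∣q∣≤∣p∣*b (outside ∷ p) M q b bound cov =
  cover⇒∣q∣≤∣p∣*b p (M ∘ suc) q b (bound ∘ there) λ j∈q → tail (cov j∈q)
  where
  tail : ∀ {j} → ∃ (λ i → i ∈ outside ∷ p × j ∈ M i) → ∃ λ i → i ∈ p × j ∈ M (suc i)
  tail (suc i , there i∈p , j∈M) = i , i∈p , j∈M
cover⇒∣q∣≤∣p∣*b (inside ∷ p) M q b bound cov = begin
  ∣ q ∣                                 ≡⟨ ∣p∣≡∣p∩q∣+∣p∩∁q∣ q (M zero) ⟩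
  ∣ q ∩ M zero ∣ + ∣ q ∩ ∁ (M zero) ∣   ≤⟨ +-mono-≤ (≤-trans (∣p∩q∣≤∣q∣ q (M zero)) (bound here)) rest ⟩
  b + ∣ p ∣ * b                         ∎
  where
  open ≤-Reasoning
  tail : ∀ {j} → j ∉ M zero →
    ∃ (λ i → i ∈ inside ∷ p × j ∈ M i) → ∃ λ i → i ∈ p × j ∈ M (suc i)
  tail j∉M₀ (zero  , here      , j∈M) = contradiction j∈M j∉M₀
  tail j∉M₀ (suc i , there i∈p , j∈M) = i , i∈p , j∈M
  rest : ∣ q ∩ ∁ (M zero) ∣ ≤ ∣ p ∣ * b
  rest = cover⇒∣q∣≤∣p∣*b p (M ∘ suc) _ b (bound ∘ there) λ j∈ →
    let j∈q , j∈∁M₀ = x∈p∩q⁻ q _ j∈ in tail (x∈∁p⇒x∉p j∈∁M₀) (cov j∈q)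

-- Minimal hitting sets and private elements.

module _ (M : Fin m → Subset n) (D : Subset n) where

  -- A hitting set: for each `j ∈ D`, `I` meets the set of those `i` with `j ∉ M i`.
  Avoids : Subset m → Set
  Avoids I = ∀ j → j ∈ D → ∃ λ i → i ∈ I × j ∉ M i

  avoidsAt? : ∀ I j → Dec (j ∈ D → ∃ λ i → i ∈ I × j ∉ M i)
  avoidsAt? I j = (j ∈? D) →-dec any? λ i → (i ∈? I) ×-dec ¬? (j ∈? M i)

  -- Supersets of avoiding sets avoid, so testing single deletions amounts to minimality under
  -- inclusion.
  Irredundant : Subset m → Set
  Irredundant I = ∀ {i} → i ∈ I → ¬ Avoids (I - i)

  ∃-irredundant : ∀ I → Avoids I → ∃ λ J → ∣ J ∣ ≤ ∣ I ∣ × Avoids J × Irredundant J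
  ∃-irredundant I = go I (⊂-wellFounded I)
    where
    go : ∀ I → Acc _⊂_ I → Avoids I → ∃ λ J → ∣ J ∣ ≤ ∣ I ∣ × Avoids J × Irredundant J
    go I (acc rec) avoids
      with any? (λ i → (i ∈? I) ×-dec all? (avoidsAt? (I - i)))
    ... | no irr = I , ≤-refl , avoids , λ i∈I av → irr (_ , i∈I , av)
    ... | yes (i , i∈I , av) with go (I - i) (rec (x∈p⇒p-x⊂p i∈I)) av
    ...   | J , J≤ , avJ , irrJ = J , ≤-trans J≤ (∣p─q∣≤∣p∣ I ⁅ i ⁆) , avJ , irrJ

  -- Each element of `I` other than `i` has a private `j ∈ D`, which lies in `M i`, and distinct
  -- elements have distinct private ones. The extra one accounts for `i` itself.
  irredundant⇒∣I∣≤1+∣M∩D∣ : ∀ {I} → Avoids I → Irredundant I →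
    ∀ {i} → i ∈ I → ∣ I ∣ ≤ suc ∣ M i ∩ D ∣
  irredundant⇒∣I∣≤1+∣M∩D∣ {I} avoids irr {i} i∈I = begin
    ∣ I ∣                             ≡⟨ ∣p∣≡∣p∩q∣+∣p∩∁q∣ I ⁅ i ⁆ ⟩
    ∣ I ∩ ⁅ i ⁆ ∣ + ∣ I ∩ ∁ ⁅ i ⁆ ∣   ≤⟨ +-mono-≤ single others ⟩
    suc ∣ M i ∩ D ∣                   ∎
    where
    open ≤-Reasoning

    Private : Fin m → Fin n → Set
    Private i j = i ∈ I × j ∉ M i × (∀ {i′} → i′ ∈ I → i′ ≢ i → j ∈ M i′)

    private-unique : ∀ {i i′ j} → Private i j → Private i′ j → i ≡ i′
    private-unique {i} {i′} (_ , _ , others) (i′∈I , j∉M , _) =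
      decidable-stable (i ≟ i′) λ i≢i′ → j∉M (others i′∈I (i≢i′ ∘ sym))

    ∃-private : ∀ {i} → i ∈ I → ∃ λ j → j ∈ D × Private i j
    -- A `j` at which `I - i` fails to avoid is private to `i`.
    ∃-private {i} i∈I with ¬∀⟶∃¬ _ _ (avoidsAt? (I - i)) (irr i∈I)
    ... | j , ¬av = j , j∈D , i∈I , j∉M , others
      where
      j∈D : j ∈ D
      j∈D = decidable-stable (j ∈? D) λ j∉D → ¬av λ j∈D → contradiction j∈D j∉D
      others : ∀ {i′} → i′ ∈ I → i′ ≢ i → j ∈ M i′
      others {i′} i′∈I i′≢i = decidable-stable (j ∈? M i′) λ j∉M →
        ¬av λ _ → i′ , x∈p∧x≢y⇒x∈p-y i′∈I i′≢i , j∉M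
      j∉M : j ∉ M i
      j∉M j∈M with avoids j j∈D
      ... | i₀ , i₀∈I , j∉M₀ with i₀ ≟ i
      ...   | yes refl = j∉M₀ j∈M
      ...   | no i₀≢i  = j∉M₀ (others i₀∈I i₀≢i)

    single : ∣ I ∩ ⁅ i ⁆ ∣ ≤ 1
    single = ≤-trans (∣p∩q∣≤∣q∣ I ⁅ i ⁆) (≤-reflexive (∣⁅x⁆∣≡1 i))

    private-in : ∀ {i′} → i′ ∈ I ∩ ∁ ⁅ i ⁆ → ∃ λ j → j ∈ M i ∩ D × Private i′ j
    private-in i′∈ with x∈p∩q⁻ I _ i′∈
    ... | i′∈I , i′∈∁ with ∃-private i′∈I
    ...   | j , j∈D , priv@(_ , _ , others) =
      j , x∈p∩q⁺ (others i∈I (λ { refl → x∈∁p⇒x∉p i′∈∁ (x∈⁅x⁆ i) }) , j∈D) , priv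

    others : ∣ I ∩ ∁ ⁅ i ⁆ ∣ ≤ ∣ M i ∩ D ∣
    others = injective⇒∣p∣≤∣q∣ _ _ Private private-in private-unique

-- Degrees, and classes near a vertex.

module _ (G : Graph n) where

  degree≤maxDegree : ∀ v → degree G v ≤ maxDegree G
  degree≤maxDegree v =
    v≤max⁺ 0 _ (inj₂ (Any.map ≤-reflexive (∈-map⁺ (degree G) (∈-allFin v))))

  -- When the list minimum is its default value n, any vertex will do.
  ∃-degree≤minDegree : Fin n → ∃ λ x → degree G x ≤ minDegree G
  ∃-degree≤minDegree v with argmin-sel id n (map (degree G) (allFin n))
  ... | inj₁ min≡n = v , ≤-trans (∣p∣≤n (neighbourhood G v)) (≤-reflexive (sym min≡n))
  ... | inj₂ min∈ with ∈-map⁻ (degree G) min∈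
  ...   | x , _ , min≡ = x , ≤-reflexive (sym min≡)

  ∃-undominated : ∀ {T} → ¬ TotalDominating G T → ∃ λ v → ∀ {u} → u ∈ T → ¬ Adj G v u
  ∃-undominated {T} ¬dom
    with ¬∀⟶∃¬ _ _ (λ v → any? λ u → (u ∈? T) ×-dec adj? G v u) ¬dom
  ... | v , ¬nbr = v , λ u∈T adj → ¬nbr (_ , u∈T , adj)

  module _ (C : Fin k → Subset n) where

    Near : Fin n → Fin k → Set
    Near v i = ∃ λ u → u ∈ C i × Adj G v u

    near? : ∀ v → Decidable (Near v)
    near? v i = any? λ u → (u ∈? C i) ×-dec adj? G v u

    near : Fin n → Subset k
    near v = tabulate (does ∘ near? v)

    -- The union of the two classes contains a neighbour of `v`, which must lie in one of them.
    coalition⇒near : ∀ {i j} → TotalCoalition G (C i) (C j) → ∀ v → i ∉ near v → j ∈ near v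
    coalition⇒near {i} {j} tc v i∉ with TotalCoalition.union tc v
    ... | u , u∈∪ , adj with x∈p∪q⁻ (C i) (C j) u∈∪
    ...   | inj₁ u∈Cᵢ = contradiction (∈-tabulate-does⁺ (near? v) (u , u∈Cᵢ , adj)) i∉
    ...   | inj₂ u∈Cⱼ = ∈-tabulate-does⁺ (near? v) (u , u∈Cⱼ , adj)

    module _ (part : IsPartition G C) where

      class-unique : ∀ {i j u} → u ∈ C i → u ∈ C j → i ≡ j
      class-unique {i} {j} u∈Cᵢ u∈Cⱼ = decidable-stable (i ≟ j) λ i≢j →
        IsPartition.disjoint part i≢j (_ , x∈p∩q⁺ (u∈Cᵢ , u∈Cⱼ))

      -- Each near class contains a neighbour of `v`, and disjoint classes cannot share one.
      ∣near∣≤degree : ∀ v → ∣ near v ∣ ≤ degree G v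
      ∣near∣≤degree v =
        injective⇒∣p∣≤∣q∣ (near v) (neighbourhood G v) (λ i u → u ∈ C i) meets class-unique
        where
        meets : ∀ {i} → i ∈ near v → ∃ λ u → u ∈ neighbourhood G v × u ∈ C i
        meets i∈ with ∈-tabulate-does⁻ (near? v) i∈
        ... | u , u∈C , adj = u , ∈-tabulate-does⁺ (adj? G v) adj , u∈C

    module _ (tcp : IsTotalCoalitionPartition G C) where

      open IsTotalCoalitionPartition tcp

      private
        undominated : ∀ i → ∃ λ v → ∀ {u} → u ∈ C i → ¬ Adj G v u
        undominated i = ∃-undominated (TotalCoalition.¬left (proj₂ (proj₂ (partner i))))

        M : Fin k → Subset k
        M i = near (proj₁ (undominated i))

        i∉M[i] : ∀ i → i ∉ M i
        i∉M[i] i i∈M with ∈-tabulate-does⁻ (near? (proj₁ (undominated i))) i∈M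
        ... | _ , u∈C , adj = proj₂ (undominated i) u∈C adj

      ∃-class-bound : ∀ x → ∃ λ s → s ≤ degree G x ×
        k ≤ degree G x + s * (suc (maxDegree G) ∸ s)
      -- The search starts from `near x` itself, where each `j` is its own witness because
      -- `j ∉ M j`.
      ∃-class-bound x with ∃-irredundant M (near x) (near x) (λ j j∈D → j , j∈D , i∉M[i] j)
      ... | I , ∣I∣≤∣D∣ , avoids , irr = ∣ I ∣ , ≤-trans ∣I∣≤∣D∣ ∣D∣≤deg , (begin
        k                      ≡⟨ m+[n∸m]≡n (∣p∣≤n D) ⟨
        ∣ D ∣ + (k ∸ ∣ D ∣)    ≡⟨ cong (∣ D ∣ +_) (∣∁p∣≡n∸∣p∣ D) ⟨
        ∣ D ∣ + ∣ ∁ D ∣        ≤⟨ +-mono-≤ ∣D∣≤deg (cover⇒∣q∣≤∣p∣*b I (λ i → M i ∩ ∁ D) (∁ D) _ bound cover) ⟩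
        degree G x + ∣ I ∣ * (suc (maxDegree G) ∸ ∣ I ∣) ∎)
        where
        open ≤-Reasoning
        D : Subset k
        D = near x

        ∣D∣≤deg : ∣ D ∣ ≤ degree G x
        ∣D∣≤deg = ∣near∣≤degree isPartition x

        bound : ∀ {i} → i ∈ I → ∣ M i ∩ ∁ D ∣ ≤ suc (maxDegree G) ∸ ∣ I ∣
        bound {i} i∈I = m+n≤o⇒m≤o∸n _ (begin
          ∣ M i ∩ ∁ D ∣ + ∣ I ∣             ≤⟨ +-monoʳ-≤ _ (irredundant⇒∣I∣≤1+∣M∩D∣ M D avoids irr i∈I) ⟩
          ∣ M i ∩ ∁ D ∣ + suc ∣ M i ∩ D ∣   ≡⟨ +-comm _ (suc ∣ M i ∩ D ∣) ⟩
          suc (∣ M i ∩ D ∣ + ∣ M i ∩ ∁ D ∣) ≡⟨ cong suc (∣p∣≡∣p∩q∣+∣p∩∁q∣ (M i) D) ⟨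
          suc ∣ M i ∣                       ≤⟨ s≤s (∣near∣≤degree isPartition _) ⟩
          suc (degree G _)                  ≤⟨ s≤s (degree≤maxDegree _) ⟩
          suc (maxDegree G)                 ∎)

        cover : ∀ {c} → c ∈ ∁ D → ∃ λ i → i ∈ I × c ∈ M i ∩ ∁ D
        cover {c} c∈∁D with partner c
        -- As `c` is not near `x`, its partner `j` is. Some `i ∈ I` then has `j ∉ M i`, and the same
        -- argument at the vertex undominated by `i` puts `c` into `M i`.
        ... | j , _ , tc with avoids j (coalition⇒near tc x (x∈∁p⇒x∉p c∈∁D))
        ...   | i , i∈I , j∉M = i , i∈I , x∈p∩q⁺
          ( decidable-stable (c ∈? M i) (λ c∉M → j∉M (coalition⇒near tc _ c∉M))
          , c∈∁D )

-- Arithmetic of the bound.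

d+s[1+Δ∸s]≤d[Δ∸d+2] : ∀ {s d Δ} → s ≤ d → d + d ≤ Δ → d + s * (suc Δ ∸ s) ≤ d * (Δ ∸ d + 2)
d+s[1+Δ∸s]≤d[Δ∸d+2] {s} s≤d 2d≤Δ with m≤n⇒∃[o]m+o≡n s≤d | m≤n⇒∃[o]m+o≡n 2d≤Δ
-- With `d = s + e` and `Δ = 2d + r` the truncated subtractions disappear, and the right side
-- exceeds the left by exactly `e * (e + r + 1)`.
... | e , refl | r , refl = begin
  (s + e) + s * (suc (s + e + (s + e) + r) ∸ s)
    ≡⟨ cong (λ z → s + e + s * (z ∸ s)) (split s e r) ⟩
  (s + e) + s * ((s + suc (s + e + e + r)) ∸ s)
    ≡⟨ cong (λ z → s + e + s * z) (m+n∸m≡n s _) ⟩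
  (s + e) + s * suc (s + e + e + r)
    ≤⟨ m≤m+n _ (e * (e + r + 1)) ⟩
  (s + e) + s * suc (s + e + e + r) + e * (e + r + 1)
    ≡⟨ expand s e r ⟩
  (s + e) * ((s + e + r) + 2)
    ≡⟨ cong (λ z → (s + e) * (z + 2)) (m+n∸m≡n (s + e) _) ⟨
  (s + e) * ((s + e + (s + e + r)) ∸ (s + e) + 2)
    ≡⟨ cong (λ z → (s + e) * (z ∸ (s + e) + 2)) (+-assoc (s + e) (s + e) r) ⟨
  (s + e) * ((s + e + (s + e) + r) ∸ (s + e) + 2) ∎
  where
  open ≤-Reasoning
  split : ∀ s e r → suc (s + e + (s + e) + r) ≡ s + suc (s + e + e + r)
  split = solve-∀
  expand : ∀ s e r →
    (s + e) + s * suc (s + e + e + r) + e * (e + r + 1) ≡ (s + e) * ((s + e + r) + 2)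
  expand = solve-∀

d<[Δ+2]/2⇒d+d≤Δ : ∀ {d Δ} → d < (Δ + 2) / 2 → d + d ≤ Δ
d<[Δ+2]/2⇒d+d≤Δ {d} {Δ} d< = +-cancelʳ-≤ 2 _ _ (begin
  d + d + 2         ≡⟨ double d ⟩
  suc d * 2         ≤⟨ *-monoˡ-≤ 2 d< ⟩
  (Δ + 2) / 2 * 2   ≤⟨ m/n*n≤m (Δ + 2) 2 ⟩
  Δ + 2             ∎)
  where
  open ≤-Reasoning
  double : ∀ d → d + d + 2 ≡ suc d * 2
  double = solve-∀

theorem4p2 : ∀ {n : ℕ} (G : Graph n) → IsolateFree G →
    minDegree G < (maxDegree G + 2) / 2 →
    ∀ (t : ℕ) → IsTC G t →
    t ≤ minDegree G * (maxDegree G ∸ minDegree G + 2)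
theorem4p2 G _ δ< zero    _  = z≤n
theorem4p2 G _ δ< (suc t) tc = begin
  suc t                                             ≤⟨ t≤ ⟩
  degree G x + s * (suc (maxDegree G) ∸ s)          ≤⟨ +-monoˡ-≤ _ deg≤δ ⟩
  minDegree G + s * (suc (maxDegree G) ∸ s)
    ≤⟨ d+s[1+Δ∸s]≤d[Δ∸d+2] (≤-trans s≤deg deg≤δ) (d<[Δ+2]/2⇒d+d≤Δ δ<) ⟩
  minDegree G * (maxDegree G ∸ minDegree G + 2)     ∎
  where
  open ≤-Reasoning
  partition = proj₂ (IsTC.attained tc)
  -- With at least one class the graph has a vertex, so a vertex of minimum degree exists.
  v₀ = proj₁ (IsPartition.nonempty (IsTotalCoalitionPartition.isPartition partition) zero)
  low = ∃-degree≤minDegree G v₀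
  x = proj₁ low
  deg≤δ = proj₂ low
  bounds = ∃-class-bound G (proj₁ (IsTC.attained tc)) partition x
  s = proj₁ bounds
  s≤deg = proj₁ (proj₂ bounds)
  t≤ = proj₂ (proj₂ bounds)
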